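{- Every sparse paving matroid is balanced. That is: let $M=(E,\mathcal{B})$ be a paving matroid of rank $r$ on a finite ground set $E$, let $\mathcal{C}_r$ be its collection of circuits of size $r$, and suppose that $|C\oplus C'|>2$ for all distinct $C,C'\in\mathcal{C}_r$. Then every minor $N$ of $M$ (including $M$ itself) has the negative correlation property: for all distinct elements $e,f$ of the ground set of $N$ such that $f$ is not a loop of $N$, if $X$ is a basis of $N$ chosen uniformly at random, then $\Pr(e\in X\mid f\in X)\le \Pr(e\in X)$.
   Context: A matroid $M=(E,\mathcal{B})$ is given by a finite ground set $E$ and its (nonempty) collection of bases $\mathcal{B}\subseteq 2^E$; all bases have the same size $r$, the rank of $M$. A subset of $E$ is independent if it is contained in some basis, and dependent otherwise; a circuit is a minimal dependent set. A loop is an element contained in no basis; a coloop is an element contained in every basis. The symbol $\oplus$ denotes symmetric difference. $M$ of rank $r$ is paving if all $(r-1)$-element subsets of $E$ are independent; then every $r$-element subset of $E$ is either a basis or a circuit. A paving matroid of rank $r$ is sparse if $|C\oplus C'|>2$ for all distinct circuits $C,C'$ of size $r$. If $e\in E$ is neither a loop nor a coloop, the deletion $M\setminus e$ has ground set $E\setminus\{e\}$ and bases $\{X\subseteq E\setminus\{e\}: X\in\mathcal{B}\}$; the contraction $M/e$ has ground set $E\setminus\{e\}$ and bases $\{X\subseteq E\setminus\{e\}: X\cup\{e\}\in\mathcal{B}\}$. A minor of $M$ is any matroid obtained from $M$ by a (possibly empty) series of deletions and contractions. A matroid has the negative correlation property if $\Pr(e\in X\mid f\in X)\le\Pr(e\in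 X)$ for all distinct ground set elements $e,f$ with $f$ not a loop, where $X$ is a uniformly random basis. A matroid is balanced if all its minors (including itself) have the negative correlation property. -}

module Defs where

open import Data.Bool.Base using (_xor_)
open import Data.Fin.Base using (Fin; zero; suc)
open import Data.Fin.Subset
open import Data.Fin.Subset.Properties
open import Data.Integer.Base using (+_)
open import Data.List.Base as List using (List; length; filter)
open import Data.List.Membership.Propositional using () renaming (_∈_ to _∈ˡ_)
open import Data.List.Membership.Propositional.Properties
  using (∈-++⁺ˡ; ∈-++⁺ʳ; ∈-map⁺; ∈-filter⁺)
open import Data.List.Relation.Unary.Any using (here)
open import Data.Nat.Base as ℕ using (ℕ; zero; suc; _>_)
import Data.Nat.Properties as ℕ
open import Data.Product.Base using (∃-syntax; _×_; _,_; proj₁; proj₂)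
open import Data.Rational.Base as ℚ using (ℚ; _/_; _÷_)
import Data.Rational.Properties as ℚ
open import Data.Sum.Base using (_⊎_; inj₁; inj₂; [_,_]′)
open import Data.Vec.Base using ([]; _∷_; zipWith; here; there)
open import Function.Base using (_∘_)
open import Level using (0ℓ)
open import Relation.Binary.PropositionalEquality
  using (_≡_; _≢_; refl; sym; trans; cong; subst)
open import Relation.Nullary using (¬_; yes; no; contradiction)
open import Relation.Nullary.Decidable using (decidable-stable; ¬?; _×-dec_)
open import Relation.Unary using (Pred; Decidable; Satisfiable) renaming (_∩_ to _∩ᵖ_)
open import Relation.Unary.Properties using (_∩?_)

private
  variable
    n : ℕ
    x y z : Fin n
    p q : Subset n

infixl 6 _⊕_

_⊕_ : Subset n → Subset n → Subset n
_⊕_ = zipWith _xor_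

------------------------------------------------------------------------
-- Element removal and insertion

x∉p-x : ∀ (p : Subset n) x → x ∉ p - x
x∉p-x (_ ∷ _) zero    ()
x∉p-x (_ ∷ p) (suc x) (there x∈) = x∉p-x p x x∈

x∈p-y⁻ : x ∈ p - y → x ∈ p × x ≢ y
x∈p-y⁻ {p = p} {y = y} x∈ =
  p─q⊆p p ⁅ y ⁆ x∈ , λ { refl → x∉p-x p y x∈ }

x∈p∪⁅y⁆⁻ : x ∈ p ∪ ⁅ y ⁆ → x ∈ p ⊎ x ≡ y
x∈p∪⁅y⁆⁻ {p = p} {y = y} x∈ with x∈p∪q⁻ p ⁅ y ⁆ x∈
... | inj₁ x∈p = inj₁ x∈p
... | inj₂ x∈y = inj₂ (x∈⁅y⁆⇒x≡y y x∈y)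

x∈p⇒x∈p∪⁅y⁆ : x ∈ p → x ∈ p ∪ ⁅ y ⁆
x∈p⇒x∈p∪⁅y⁆ x∈p = x∈p∪q⁺ (inj₁ x∈p)

y∈p∪⁅y⁆ : ∀ (p : Subset n) y → y ∈ p ∪ ⁅ y ⁆
y∈p∪⁅y⁆ p y = x∈p∪q⁺ {p = p} (inj₂ (x∈⁅x⁆ y))

x∈p⇒∣p∣≡1+∣p-x∣ : x ∈ p → ∣ p ∣ ≡ suc ∣ p - x ∣
x∈p⇒∣p∣≡1+∣p-x∣ {p = _ ∷ p} here = cong (suc ∘ ∣_∣) (sym (p─⊥≡p p))
x∈p⇒∣p∣≡1+∣p-x∣ {p = outside ∷ _} (there x∈p) = x∈p⇒∣p∣≡1+∣p-x∣ x∈p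
x∈p⇒∣p∣≡1+∣p-x∣ {p = inside  ∷ _} (there x∈p) =
  cong suc (x∈p⇒∣p∣≡1+∣p-x∣ x∈p)

x∉p⇒∣p∪⁅x⁆∣≡1+∣p∣ : ∀ (p : Subset n) x → x ∉ p → ∣ p ∪ ⁅ x ⁆ ∣ ≡ suc ∣ p ∣
x∉p⇒∣p∪⁅x⁆∣≡1+∣p∣ (inside  ∷ p) zero    x∉p = contradiction here x∉p
x∉p⇒∣p∪⁅x⁆∣≡1+∣p∣ (outside ∷ p) zero    x∉p =
  cong (suc ∘ ∣_∣) (⊆-antisym (λ x∈ → [ (λ z → z) , (λ z → contradiction z ∉⊥) ]′
                                        (x∈p∪q⁻ p ⊥ x∈))
                              (p⊆p∪q ⊥))
x∉p⇒∣p∪⁅x⁆∣≡1+∣p∣ (outside ∷ p) (suc x) x∉p =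
  x∉p⇒∣p∪⁅x⁆∣≡1+∣p∣ p x (x∉p ∘ there)
x∉p⇒∣p∪⁅x⁆∣≡1+∣p∣ (inside  ∷ p) (suc x) x∉p =
  cong suc (x∉p⇒∣p∪⁅x⁆∣≡1+∣p∣ p x (x∉p ∘ there))

------------------------------------------------------------------------
-- Matroids

-- The ground set is a subset of an ambient Fin n, rather than Fin n itself,
-- so that a matroid and its minors have the same type.

record Matroid (n : ℕ) : Set₁ where
  field
    E        : Subset n
    Basis    : Pred (Subset n) 0ℓ
    basis?   : Decidable Basis
    basis⊆E  : ∀ {B} → Basis B → B ⊆ E
    nonempty : ∃⟨ Basis ⟩
    exchange : ∀ {B B′ x} → Basis B → Basis B′ → x ∈ B → x ∉ B′ →
               ∃[ y ] (y ∈ B′ × y ∉ B × Basis ((B - x) ∪ ⁅ y ⁆))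

  -- Independent of the choice of basis, by ∣basis∣≡rank below.
  rank : ℕ
  rank = ∣ proj₁ nonempty ∣

  Independent : Pred (Subset n) 0ℓ
  Independent S = ∃[ B ] (Basis B × S ⊆ B)

  Dependent : Pred (Subset n) 0ℓ
  Dependent S = S ⊆ E × ¬ Independent S

  Circuit : Pred (Subset n) 0ℓ
  Circuit C = Dependent C × (∀ {D} → D ⊂ C → ¬ Dependent D)

  Loop : Pred (Fin n) 0ℓ
  Loop e = e ∈ E × (∀ {B} → Basis B → e ∉ B)

  Coloop : Pred (Fin n) 0ℓ
  Coloop e = e ∈ E × (∀ {B} → Basis B → e ∈ B)

  -- "All (r-1)-element subsets are independent", without truncated
  -- subtraction: vacuous when the rank is 0.
  Paving : Set
  Paving = ∀ {S} → S ⊆ E → suc ∣ S ∣ ≡ rank → Independent S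

  SparsePaving : Set
  SparsePaving = Paving ×
    (∀ {C C′} → Circuit C → Circuit C′ → ∣ C ∣ ≡ rank → ∣ C′ ∣ ≡ rank →
     C ≢ C′ → ∣ C ⊕ C′ ∣ > 2)

module _ (M : Matroid n) where
  open Matroid M

  private
    ∣B∣≤∣B′∣ : ∀ k {B B′} → Basis B → Basis B′ → ∣ B ─ B′ ∣ ℕ.≤ k → ∣ B ∣ ℕ.≤ ∣ B′ ∣
    ∣B∣≤∣B′∣ k {B} {B′} b b′ le with nonempty? (B ─ B′)
    ... | no  B─B′≡∅ = p⊆q⇒∣p∣≤∣q∣ λ {x} x∈B → decidable-stable (x ∈? B′)
                         λ x∉B′ → B─B′≡∅ (x , x∈p∧x∉q⇒x∈p─q x∈B x∉B′)
    ... | yes (x , x∈B─B′) = step k le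
      where
      x∈─⁻ : ∀ {m} {x : Fin m} (p q : Subset m) → x ∈ p ─ q → x ∉ q
      x∈─⁻ (_ ∷ p) (inside  ∷ q) (there x∈) (there x∈q) = x∈─⁻ p q x∈ x∈q
      x∈─⁻ (_ ∷ p) (outside ∷ q) (there x∈) (there x∈q) = x∈─⁻ p q x∈ x∈q

      x∈B : x ∈ B
      x∈B = p─q⊆p B B′ x∈B─B′

      x∉B′ : x ∉ B′
      x∉B′ = x∈─⁻ B B′ x∈B─B′

      ex = exchange b b′ x∈B x∉B′
      w = proj₁ ex
      w∈B′ = proj₁ (proj₂ ex)
      w∉B = proj₁ (proj₂ (proj₂ ex))

      B″ : Subset n
      B″ = (B - x) ∪ ⁅ w ⁆

      ∣B∣≡∣B″∣ : ∣ B ∣ ≡ ∣ B″ ∣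
      ∣B∣≡∣B″∣ = trans (x∈p⇒∣p∣≡1+∣p-x∣ x∈B)
        (sym (x∉p⇒∣p∪⁅x⁆∣≡1+∣p∣ (B - x) w (w∉B ∘ proj₁ ∘ x∈p-y⁻)))

      sub : B″ ─ B′ ⊆ (B ─ B′) - x
      sub z∈ with x∈p∪⁅y⁆⁻ (p─q⊆p B″ B′ z∈)
      ... | inj₁ z∈B-x = x∈p∧x≢y⇒x∈p-y
                           (x∈p∧x∉q⇒x∈p─q (proj₁ (x∈p-y⁻ z∈B-x)) (x∈─⁻ B″ B′ z∈))
                           (proj₂ (x∈p-y⁻ z∈B-x))
      ... | inj₂ refl  = contradiction w∈B′ (x∈─⁻ B″ B′ z∈)

      smaller : ∣ B″ ─ B′ ∣ ℕ.< ∣ B ─ B′ ∣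
      smaller = ℕ.≤-<-trans (p⊆q⇒∣p∣≤∣q∣ sub) (x∈p⇒∣p-x∣<∣p∣ x∈B─B′)

      step : ∀ k → ∣ B ─ B′ ∣ ℕ.≤ k → ∣ B ∣ ℕ.≤ ∣ B′ ∣
      step zero    le = contradiction (ℕ.<-≤-trans smaller le) ℕ.n≮0
      step (suc k) le = subst (ℕ._≤ ∣ B′ ∣) (sym ∣B∣≡∣B″∣)
        (∣B∣≤∣B′∣ k (proj₂ (proj₂ (proj₂ ex))) b′ (ℕ.s≤s⁻¹ (ℕ.<-≤-trans smaller le)))

  ∣basis∣≡rank : ∀ {B} → Basis B → ∣ B ∣ ≡ rank
  ∣basis∣≡rank b = ℕ.≤-antisym (∣B∣≤∣B′∣ _ b (proj₂ nonempty) ℕ.≤-refl)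
                               (∣B∣≤∣B′∣ _ (proj₂ nonempty) b ℕ.≤-refl)

  ¬loop⇒∃basis : ∀ {e} → e ∈ E → ¬ Loop e → ∃⟨ Basis ∩ᵖ (e ∈_) ⟩
  ¬loop⇒∃basis {e} e∈E ¬loop with anySubset? (basis? ∩? (e ∈?_))
  ... | yes ∃B = ∃B
  ... | no ¬∃B = contradiction (e∈E , λ {_} b e∈B → ¬∃B (_ , b , e∈B)) ¬loop

  ¬coloop⇒∃basis : ∀ {e} → e ∈ E → ¬ Coloop e → ∃[ B ] (Basis B × e ∉ B)
  ¬coloop⇒∃basis {e} e∈E ¬coloop with anySubset? (basis? ∩? (λ B → ¬? (e ∈? B)))
  ... | yes ∃B = ∃B
  ... | no ¬∃B = contradiction
    (e∈E , λ {B} b → decidable-stable (e ∈? B) λ e∉B → ¬∃B (_ , b , e∉B)) ¬coloop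

------------------------------------------------------------------------
-- Minors

delete : (M : Matroid n) (e : Fin n) → let open Matroid M in
         e ∈ E → ¬ Loop e → ¬ Coloop e → Matroid n
delete M e e∈E _ ¬coloop = record
  { E        = E - e
  ; Basis    = λ X → X ⊆ E - e × Basis X
  ; basis?   = λ X → (X ⊆? (E - e)) ×-dec basis? X
  ; basis⊆E  = proj₁
  ; nonempty = let B , b , e∉B = ¬coloop⇒∃basis M e∈E ¬coloop in
      B , (λ x∈B → x∈p∧x≢y⇒x∈p-y (basis⊆E b x∈B) λ { refl → e∉B x∈B }) , b
  ; exchange = λ (B⊆ , b) (B′⊆ , b′) x∈B x∉B′ →
      let y , y∈B′ , y∉B , b″ = exchange b b′ x∈B x∉B′ in
      y , y∈B′ , y∉B ,
      (λ z∈ → [ (λ z∈B-x → B⊆ (proj₁ (x∈p-y⁻ z∈B-x))) , (λ { refl → B′⊆ y∈B′ }) ]′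
                (x∈p∪⁅y⁆⁻ z∈)) , b″
  }
  where open Matroid M

private
  p-x∪⁅x⁆≡p : x ∈ p → (p - x) ∪ ⁅ x ⁆ ≡ p
  p-x∪⁅x⁆≡p {x = x} {p = p} x∈p = ⊆-antisym
    (λ z∈ → [ proj₁ ∘ x∈p-y⁻ , (λ { refl → x∈p }) ]′ (x∈p∪⁅y⁆⁻ z∈))
    to
    where
    to : p ⊆ (p - x) ∪ ⁅ x ⁆
    to {z} z∈p with z ∈? ⁅ x ⁆
    ... | yes z∈x = x∈p∪q⁺ (inj₂ z∈x)
    ... | no  z∉x = x∈p∪q⁺ (inj₁ (x∈p∧x∉q⇒x∈p─q z∈p z∉x))

  swap : x ≢ z → ((p ∪ ⁅ z ⁆) - x) ∪ ⁅ y ⁆ ≡ ((p - x) ∪ ⁅ y ⁆) ∪ ⁅ z ⁆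
  swap {x = x} {z = z} {p = p} {y = y} x≢z = ⊆-antisym to from
    where
    to : ((p ∪ ⁅ z ⁆) - x) ∪ ⁅ y ⁆ ⊆ ((p - x) ∪ ⁅ y ⁆) ∪ ⁅ z ⁆
    to w∈ with x∈p∪⁅y⁆⁻ w∈
    ... | inj₂ refl = x∈p⇒x∈p∪⁅y⁆ (y∈p∪⁅y⁆ (p - x) y)
    ... | inj₁ w∈′ with x∈p-y⁻ w∈′
    ... | w∈pz , w≢x with x∈p∪⁅y⁆⁻ w∈pz
    ... | inj₁ w∈p  = x∈p⇒x∈p∪⁅y⁆ (x∈p⇒x∈p∪⁅y⁆ (x∈p∧x≢y⇒x∈p-y w∈p w≢x))
    ... | inj₂ refl = y∈p∪⁅y⁆ ((p - x) ∪ ⁅ y ⁆) z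

    from : ((p - x) ∪ ⁅ y ⁆) ∪ ⁅ z ⁆ ⊆ ((p ∪ ⁅ z ⁆) - x) ∪ ⁅ y ⁆
    from w∈ with x∈p∪⁅y⁆⁻ w∈
    ... | inj₂ refl = x∈p⇒x∈p∪⁅y⁆ (x∈p∧x≢y⇒x∈p-y (y∈p∪⁅y⁆ p z) (x≢z ∘ sym))
    ... | inj₁ w∈′ with x∈p∪⁅y⁆⁻ w∈′
    ... | inj₂ refl = y∈p∪⁅y⁆ ((p ∪ ⁅ z ⁆) - x) y
    ... | inj₁ w∈p-x with x∈p-y⁻ w∈p-x
    ... | w∈p , w≢x = x∈p⇒x∈p∪⁅y⁆ (x∈p∧x≢y⇒x∈p-y (x∈p⇒x∈p∪⁅y⁆ w∈p) w≢x)

contract : (M : Matroid n) (e : Fin n) → let open Matroid M in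
           e ∈ E → ¬ Loop e → ¬ Coloop e → Matroid n
contract M e e∈E ¬loop _ = record
  { E        = E - e
  ; Basis    = λ X → X ⊆ E - e × Basis (X ∪ ⁅ e ⁆)
  ; basis?   = λ X → (X ⊆? (E - e)) ×-dec basis? (X ∪ ⁅ e ⁆)
  ; basis⊆E  = proj₁
  ; nonempty = let B , b , e∈B = ¬loop⇒∃basis M e∈E ¬loop in
      B - e ,
      (λ x∈ → let x∈B , x≢e = x∈p-y⁻ x∈ in x∈p∧x≢y⇒x∈p-y (basis⊆E b x∈B) x≢e) ,
      subst Basis (sym (p-x∪⁅x⁆≡p e∈B)) b
  ; exchange = exch
  }
  where
  open Matroid M

  exch : ∀ {B B′ x} → B ⊆ E - e × Basis (B ∪ ⁅ e ⁆) →
         B′ ⊆ E - e × Basis (B′ ∪ ⁅ e ⁆) → x ∈ B → x ∉ B′ →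
         ∃[ y ] (y ∈ B′ × y ∉ B × (B - x) ∪ ⁅ y ⁆ ⊆ E - e ×
                 Basis (((B - x) ∪ ⁅ y ⁆) ∪ ⁅ e ⁆))
  exch {B} {B′} {x} (B⊆ , b) (B′⊆ , b′) x∈B x∉B′
    with exchange b b′ (x∈p⇒x∈p∪⁅y⁆ x∈B) ([ x∉B′ , proj₂ (x∈p-y⁻ (B⊆ x∈B)) ]′ ∘ x∈p∪⁅y⁆⁻)
  ... | y , y∈ , y∉ , b″ with x∈p∪⁅y⁆⁻ {p = B′} y∈
  ...   | inj₂ refl = contradiction (y∈p∪⁅y⁆ B e) y∉
  ...   | inj₁ y∈B′ = y , y∈B′ , y∉ ∘ x∈p⇒x∈p∪⁅y⁆ ,
      (λ z∈ → [ (λ z∈B-x → B⊆ (proj₁ (x∈p-y⁻ z∈B-x))) , (λ { refl → B′⊆ y∈B′ }) ]′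
                (x∈p∪⁅y⁆⁻ z∈)) ,
      subst Basis (swap (proj₂ (x∈p-y⁻ (B⊆ x∈B)))) b″

data Minor (M : Matroid n) : Matroid n → Set₁ where
  self        : Minor M M
  deletion    : ∀ {N e} → Minor M N → let open Matroid N in
                (e∈E : e ∈ E) (¬loop : ¬ Loop e) (¬coloop : ¬ Coloop e) →
                Minor M (delete N e e∈E ¬loop ¬coloop)
  contraction : ∀ {N e} → Minor M N → let open Matroid N in
                (e∈E : e ∈ E) (¬loop : ¬ Loop e) (¬coloop : ¬ Coloop e) →
                Minor M (contract N e e∈E ¬loop ¬coloop)

------------------------------------------------------------------------
-- Counting

subsets : ∀ n → List (Subset n)
subsets zero    = [] List.∷ List.[]
subsets (suc n) = List.map (inside ∷_) (subsets n) List.++ List.map (outside ∷_) (subsets n)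

∈-subsets : ∀ (p : Subset n) → p ∈ˡ subsets n
∈-subsets []            = here refl
∈-subsets (inside  ∷ p) = ∈-++⁺ˡ (∈-map⁺ (inside ∷_) (∈-subsets p))
∈-subsets (outside ∷ p) = ∈-++⁺ʳ _ (∈-map⁺ (outside ∷_) (∈-subsets p))

# : {P : Pred (Subset n) 0ℓ} → Decidable P → ℕ
# P? = length (filter P? (subsets _))

#-nonZero : {P : Pred (Subset n) 0ℓ} (P? : Decidable P) → ∃⟨ P ⟩ → ℕ.NonZero (# P?)
#-nonZero P? (p , Pp) = nonEmpty (∈-filter⁺ P? (∈-subsets p) Pp)
  where
  nonEmpty : ∀ {A : Set} {a : A} {as} → a ∈ˡ as → ℕ.NonZero (length as)
  nonEmpty {as = _ List.∷ _} _ = _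

------------------------------------------------------------------------
-- Negative correlation

-- Pr M A? is the probability that a uniformly random basis of M satisfies A.

module _ (M : Matroid n) where
  open Matroid M

  Pr : {A : Pred (Subset n) 0ℓ} → Decidable A → ℚ
  Pr A? = (+ # (basis? ∩? A?) / # basis?) {{#-nonZero basis? nonempty}}

  Pr[_∣_] : {A C : Pred (Subset n) 0ℓ} (A? : Decidable A) (C? : Decidable C) →
            .{{ℚ.NonZero (Pr C?)}} → ℚ
  Pr[ A? ∣ C? ] = Pr (A? ∩? C?) ÷ Pr C?

  Pr-nonZero : {A : Pred (Subset n) 0ℓ} (A? : Decidable A) →
               ∃⟨ Basis ∩ᵖ A ⟩ → ℚ.NonZero (Pr A?)
  Pr-nonZero A? ∃B = ℚ.pos⇒nonZero (Pr A?)
    {{ℚ.normalize-pos (# (basis? ∩? A?)) (# basis?)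
        {{#-nonZero basis? nonempty}} {{#-nonZero (basis? ∩? A?) ∃B}}}}

  NegativelyCorrelated : Set
  NegativelyCorrelated =
    ∀ {e f} → e ∈ E → (f∈E : f ∈ E) → e ≢ f → (¬loop : ¬ Loop f) →
    Pr[_∣_] (e ∈?_) (f ∈?_) {{Pr-nonZero (f ∈?_) (¬loop⇒∃basis M f∈E ¬loop)}}
      ℚ.≤ Pr (e ∈?_)

Balanced : Matroid n → Set₁
Balanced M = ∀ {N} → Minor M N → NegativelyCorrelated N

{-# OPTIONS --safe #-}
module Submission where

-- Sparse paving enters only through the fact that no two non-bases of rank size
-- differ by a single exchange, and this passes to minors.  Let F = E ∖ {e, f},
-- r = s + 1 the rank, q = ∣F∣ - s, and L k the number of k-subsets of F.  The
-- s-subsets X of F with X ∪ {e} not a basis have pairwise disjoint upper shadows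
-- in F, and those with X ∪ {f} not a basis have pairwise disjoint lower shadows.
-- By double counting there are at most L s / (s + 1) of the former and at most
-- L s / (q + 1) of the latter.  Hence
--
--   #(e, not f) · #(f, not e) ≥ s / (s + 1) · L s · q / (q + 1) · L s
--                             = L (s - 1) · L (s + 1)
--                             ≥ #(e and f) · #(neither),
--
-- where # counts bases; this is equivalent to negative correlation.

open import Defs
import Algebra.Properties.Semiring.Sum as Sum
open import Data.Bool.Base using (true; false; if_then_else_; _∨_)
open import Data.Bool.Properties using (∨-identityʳ)
open import Data.Fin.Base using (Fin; zero; suc)
open import Data.Fin.Properties using (any?) renaming (_≟_ to _≟ᶠ_)
open import Data.Fin.Subset
open import Data.Fin.Subset.Properties
import Data.Integer.Base as ℤ
import Data.Integer.Properties as ℤ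
open import Data.List.Base as List using (List; length; filter)
open import Data.List.Properties using (filter-≐; filter-++; length-++)
open import Data.Nat.Base
open import Data.Nat.ListAction using (sum)
open import Data.Nat.Properties
open import Data.Nat.Tactic.RingSolver using (solve-∀)
open import Data.Product.Base using (_×_; _,_; proj₁; proj₂)
import Data.Rational.Base as ℚ
import Data.Rational.Properties as ℚ
import Data.Rational.Unnormalised.Base as ℚᵘ
import Data.Rational.Unnormalised.Properties as ℚᵘ
open import Data.Sum.Base using (_⊎_; inj₁; inj₂; [_,_]′)
open import Data.Vec.Base using ([]; _∷_; here; there)
open import Function.Base using (_∘_; id)
open import Level using (0ℓ)
open import Relation.Binary.PropositionalEquality
  using (_≡_; _≢_; refl; sym; trans; cong; cong₂; subst; subst₂; ≢-sym; module ≡-Reasoning)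
open import Relation.Nullary using (¬_; Dec; yes; no; does; contradiction)
open import Relation.Nullary.Decidable using (¬?; _×-dec_; decidable-stable)
open import Relation.Unary using (Pred; Decidable; _≐_) renaming (_⊆_ to _⊆ᵖ_)
open import Relation.Unary.Properties using (_∩?_)

open Sum +-*-semiring
  using (∑-distrib-+; sum-cong-≗; sum-replicate-zero) renaming (sum to Σ)

private
  variable
    n a k j : ℕ
    x y z   : Fin n
    p q X   : Subset n
    A       : Set
    P Q     : Pred A 0ℓ

-- Counting list entries and subsets by decidable predicates.

χ : ∀ {P : Set} → Dec P → ℕ
χ P? = if does P? then 1 else 0

count : {P : Pred A 0ℓ} → Decidable P → List A → ℕ
count P? xs = length (filter P? xs)

count-∷ : {P : Pred A 0ℓ} (P? : Decidable P) (x : A) (xs : List A) →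
          count P? (x List.∷ xs) ≡ χ (P? x) + count P? xs
count-∷ P? x xs with does (P? x)
... | true  = refl
... | false = refl

χ-mono : ∀ {P Q : Set} (P? : Dec P) (Q? : Dec Q) → (P → Q) → χ P? ≤ χ Q?
χ-mono (no _)  _       _ = z≤n
χ-mono (yes p) (yes _) _ = ≤-refl
χ-mono (yes p) (no ¬q) f = contradiction (f p) ¬q

count-mono : (P? : Decidable P) (Q? : Decidable Q) → P ⊆ᵖ Q →
             ∀ (xs : List _) → count P? xs ≤ count Q? xs
count-mono P? Q? P⊆Q List.[] = z≤n
count-mono P? Q? P⊆Q (x List.∷ xs)
  rewrite count-∷ P? x xs | count-∷ Q? x xs =
  +-mono-≤ (χ-mono (P? x) (Q? x) P⊆Q) (count-mono P? Q? P⊆Q xs)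

count-cong : (P? : Decidable P) (Q? : Decidable Q) → P ≐ Q →
             ∀ (xs : List _) → count P? xs ≡ count Q? xs
count-cong P? Q? P≐Q xs = cong length (filter-≐ P? Q? P≐Q xs)

count-split : (P? : Decidable P) (Q? : Decidable Q) (xs : List _) →
              count P? xs ≡ count (P? ∩? Q?) xs + count (P? ∩? (¬? ∘ Q?)) xs
count-split P? Q? List.[] = refl
count-split P? Q? (x List.∷ xs) with does (P? x) | does (Q? x)
... | true  | true  = cong suc (count-split P? Q? xs)
... | true  | false = trans (cong suc (count-split P? Q? xs)) (sym (+-suc _ _))
... | false | _     = count-split P? Q? xs

count-map : {B : Set} {P : Pred B 0ℓ} (f : A → B) (P? : Decidable P) (xs : List A) →
            count P? (List.map f xs) ≡ count (P? ∘ f) xs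
count-map f P? List.[] = refl
count-map f P? (x List.∷ xs)
  rewrite count-∷ P? (f x) (List.map f xs) | count-∷ (P? ∘ f) x xs =
  cong (χ (P? (f x)) +_) (count-map f P? xs)

#-suc : {P : Pred (Subset (suc n)) 0ℓ} (P? : Decidable P) →
        # P? ≡ # (P? ∘ (inside ∷_)) + # (P? ∘ (outside ∷_))
#-suc {n = n} P? = begin
  # P? ≡⟨ cong length (filter-++ P? (List.map (inside ∷_) (subsets n)) _) ⟩
  _    ≡⟨ length-++ (filter P? (List.map (inside ∷_) (subsets n))) ⟩
  _    ≡⟨ cong₂ _+_ (count-map (inside ∷_) P? (subsets n))
                    (count-map (outside ∷_) P? (subsets n)) ⟩
  # (P? ∘ (inside ∷_)) + # (P? ∘ (outside ∷_)) ∎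
  where open ≡-Reasoning

#-none : {P : Pred (Subset n) 0ℓ} (P? : Decidable P) → (∀ {X} → ¬ P X) → # P? ≡ 0
#-none P? ¬P = go (subsets _)
  where
  go : ∀ xs → count P? xs ≡ 0
  go List.[] = refl
  go (x List.∷ xs) with P? x
  ... | yes p = contradiction p ¬P
  ... | no _  = go xs

-- `X ↦ X ∪ ⁅ y ⁆` is a bijection from the sets avoiding `y` onto those containing it. Every
-- comparison of counts at different sizes goes through this identity.
#-insert : ∀ (y : Fin n) {P : Pred (Subset n) 0ℓ} (P? : Decidable P) →
           # (λ X → (y ∈? X) ×-dec P? X) ≡
           # (λ X → ¬? (y ∈? X) ×-dec P? (X ∪ ⁅ y ⁆))
#-insert zero {P} P? = begin
  _ ≡⟨ #-suc (λ X → (zero ∈? X) ×-dec P? X) ⟩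
  _ ≡⟨ cong₂ _+_
         (count-cong (λ X → (zero ∈? (inside ∷ X)) ×-dec P? (inside ∷ X))
                     (λ X → ¬? (zero ∈? (outside ∷ X)) ×-dec P? (inside ∷ (X ∪ ⊥)))
            ((λ { {X} (_ , p) → (λ ()) , subst (P ∘ (inside ∷_)) (sym (∪-identityʳ X)) p }) ,
             (λ { {X} (_ , p) → here , subst (P ∘ (inside ∷_)) (∪-identityʳ X) p }))
            (subsets _))
         (#-none (λ X → (zero ∈? (outside ∷ X)) ×-dec P? (outside ∷ X)) λ { (() , _) }) ⟩
  -- The empty half is the `outside` one before the bijection and the `inside` one after it.
  _ ≡⟨ +-comm _ 0 ⟩
  _ ≡⟨ cong (_+ # (λ X → ¬? (zero ∈? (outside ∷ X)) ×-dec P? (inside ∷ (X ∪ ⊥))))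
         (#-none (λ X → ¬? (zero ∈? (inside ∷ X)) ×-dec P? (inside ∷ (X ∪ ⊥)))
         λ { (z∉ , _) → z∉ here }) ⟨
  _ ≡⟨ #-suc (λ X → ¬? (zero ∈? X) ×-dec P? (X ∪ ⁅ zero ⁆)) ⟨
  _ ∎
  where open ≡-Reasoning
#-insert (suc y) P? = begin
  _ ≡⟨ #-suc (λ X → (suc y ∈? X) ×-dec P? X) ⟩
  _ ≡⟨ cong₂ _+_ (step inside) (step outside) ⟩
  _ ≡⟨ #-suc (λ X → ¬? (suc y ∈? X) ×-dec P? (X ∪ ⁅ suc y ⁆)) ⟨
  _ ∎
  where
  open ≡-Reasoning

  step : ∀ b → # (λ X → (suc y ∈? (b ∷ X)) ×-dec P? (b ∷ X)) ≡
               # (λ X → ¬? (suc y ∈? (b ∷ X)) ×-dec P? ((b ∨ outside) ∷ (X ∪ ⁅ y ⁆)))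
  step b rewrite ∨-identityʳ b = begin
    _ ≡⟨ count-cong (λ X → (suc y ∈? (b ∷ X)) ×-dec P? (b ∷ X))
                    (λ X → (y ∈? X) ×-dec P? (b ∷ X))
                    ((λ { (there y∈ , p) → y∈ , p }) , (λ { (y∈ , p) → there y∈ , p })) (subsets _) ⟩
    _ ≡⟨ #-insert y (P? ∘ (b ∷_)) ⟩
    _ ≡⟨ count-cong (λ X → ¬? (suc y ∈? (b ∷ X)) ×-dec P? (b ∷ (X ∪ ⁅ y ⁆)))
                    (λ X → ¬? (y ∈? X) ×-dec P? (b ∷ (X ∪ ⁅ y ⁆)))
                    ((λ { (y∉ , p) → y∉ ∘ there , p }) ,
                     (λ { (y∉ , p) → (λ { (there y∈) → y∉ y∈ }) , p })) (subsets _) ⟨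
    _ ∎

-- Indicator sums over `Fin n` and double counting.

Σ-mono-≤ : {f g : Fin n → ℕ} → (∀ i → f i ≤ g i) → Σ f ≤ Σ g
Σ-mono-≤ {n = zero}  f≤g = z≤n
Σ-mono-≤ {n = suc n} f≤g = +-mono-≤ (f≤g zero) (Σ-mono-≤ (f≤g ∘ suc))

Σχ∈≡∣p∣ : (p : Subset n) → Σ (λ y → χ (y ∈? p)) ≡ ∣ p ∣
Σχ∈≡∣p∣ []            = refl
Σχ∈≡∣p∣ (inside  ∷ p) = cong suc (Σχ∈≡∣p∣ p)
Σχ∈≡∣p∣ (outside ∷ p) = Σχ∈≡∣p∣ p

module _ {R : Pred (Fin n) 0ℓ} (R? : Decidable R) where

  ∣p∣≤Σχ : (p : Subset n) → (∀ {y} → y ∈ p → R y) → ∣ p ∣ ≤ Σ (χ ∘ R?)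
  ∣p∣≤Σχ p p⊆R = subst (_≤ Σ (χ ∘ R?)) (Σχ∈≡∣p∣ p)
    (Σ-mono-≤ λ y → χ-mono (y ∈? p) (R? y) p⊆R)

  Σχ≤∣p∣ : (p : Subset n) → (∀ {y} → R y → y ∈ p) → Σ (χ ∘ R?) ≤ ∣ p ∣
  Σχ≤∣p∣ p R⊆p = subst (Σ (χ ∘ R?) ≤_) (Σχ∈≡∣p∣ p)
    (Σ-mono-≤ λ y → χ-mono (R? y) (y ∈? p) R⊆p)

  Σχ-none : (∀ {y} → ¬ R y) → Σ (χ ∘ R?) ≡ 0
  Σχ-none ¬R = n≤0⇒n≡0 (subst (Σ (χ ∘ R?) ≤_) (∣⊥∣≡0 n) (Σχ≤∣p∣ ⊥ λ r → contradiction r ¬R))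

  Σχ-unique : (∀ {y z} → R y → R z → y ≡ z) → Σ (χ ∘ R?) ≤ 1
  Σχ-unique unique with any? R?
  ... | yes (y , r) = subst (Σ (χ ∘ R?) ≤_) (∣⁅x⁆∣≡1 y)
    (Σχ≤∣p∣ ⁅ y ⁆ λ r′ → subst (_∈ ⁅ y ⁆) (unique r r′) (x∈⁅x⁆ y))
  ... | no ¬∃ = ≤-trans (≤-reflexive (Σχ-none λ r → ¬∃ (_ , r))) z≤n

module _ {A : Set} {P : Pred A 0ℓ} (P? : Decidable P)
         {R : A → Pred (Fin n) 0ℓ} (R? : ∀ X → Decidable (R X)) where

  private
    degree : A → ℕ
    degree X = Σ (χ ∘ R? X)

    -- Exchange of a double sum: both sides count the pairs of an entry `X` and an element `y` with
    -- `R X y`.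
    handshake : ∀ xs → Σ (λ y → count (λ X → R? X y) xs) ≡ sum (List.map degree xs)
    handshake List.[] = sum-replicate-zero n
    handshake (X List.∷ xs) = trans
      (sum-cong-≗ λ y → count-∷ (λ X → R? X y) X xs)
      (trans (∑-distrib-+ (χ ∘ R? X) (λ y → count (λ X → R? X y) xs))
             (cong (degree X +_) (handshake xs)))

  handshake-≥ : (∀ {X} → P X → a ≤ Σ (χ ∘ R? X)) → ∀ xs →
                a * count P? xs ≤ Σ (λ y → count (λ X → R? X y) xs)
  handshake-≥ {a} h xs = subst (a * count P? xs ≤_) (sym (handshake xs)) (go xs)
    where
    go : ∀ xs → a * count P? xs ≤ sum (List.map degree xs)
    go List.[] = ≤-reflexive (*-zeroʳ a)
    go (X List.∷ xs) with P? X
    ... | yes p = ≤-trans (≤-reflexive (*-suc a _)) (+-mono-≤ (h p) (go xs))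
    ... | no _  = ≤-trans (go xs) (m≤n+m _ _)

  handshake-≤ : (∀ {X} → P X → Σ (χ ∘ R? X) ≤ a) → (∀ {X y} → R X y → P X) → ∀ xs →
                Σ (λ y → count (λ X → R? X y) xs) ≤ a * count P? xs
  handshake-≤ {a} h R⇒P xs = subst (_≤ a * count P? xs) (sym (handshake xs)) (go xs)
    where
    go : ∀ xs → sum (List.map degree xs) ≤ a * count P? xs
    go List.[] = z≤n
    go (X List.∷ xs) with P? X
    ... | yes p = ≤-trans (+-mono-≤ (h p) (go xs)) (≤-reflexive (sym (*-suc a _)))
    -- An entry outside `P` has degree 0, since any `R X y` would put it in `P`.
    ... | no ¬p = ≤-trans (≤-reflexive (cong (_+ _) (Σχ-none (R? X) λ r → ¬p (R⇒P r)))) (go xs)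

-- A bipartite graph with edges from `X` to `X ∪ ⁅ y ⁆` for `y ∉ X`. The relation `R` selects edges
-- and is read at the upper end, which is why `lower?` evaluates it at `X ∪ ⁅ y ⁆`.
module DoubleCounting
  {P Q : Pred (Subset n) 0ℓ} (P? : Decidable P) (Q? : Decidable Q)
  {R : Subset n → Pred (Fin n) 0ℓ} (R? : ∀ X → Decidable (R X)) where

  lower? : ∀ X → Decidable (λ y → y ∉ X × R (X ∪ ⁅ y ⁆) y)
  lower? X y = ¬? (y ∈? X) ×-dec R? (X ∪ ⁅ y ⁆) y

  upper? : ∀ X → Decidable (λ y → y ∈ X × R X y)
  upper? X y = (y ∈? X) ×-dec R? X y

  upper≡lower : Σ (λ y → # (λ X → upper? X y)) ≡ Σ (λ y → # (λ X → lower? X y))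
  upper≡lower = sum-cong-≗ λ y → #-insert y (λ X → R? X y)

  module _ {a b : ℕ} where

    -- Edges are counted at both ends: at least `a` leave each `P`-set upwards, at most `b` leave
    -- each `Q`-set downwards, and by the last hypothesis every upper end satisfies `Q`.
    upwards : (∀ {X} → P X → a ≤ Σ (χ ∘ lower? X)) →
              (∀ {Y} → Q Y → Σ (χ ∘ upper? Y) ≤ b) →
              (∀ {Y y} → y ∈ Y → R Y y → Q Y) →
              a * # P? ≤ b * # Q?
    upwards P⇒a Q⇒b R⇒Q = begin
      a * # P?                       ≤⟨ handshake-≥ P? lower? P⇒a (subsets n) ⟩
      Σ (λ y → # (λ X → lower? X y)) ≡⟨ upper≡lower ⟨
      Σ (λ y → # (λ X → upper? X y)) ≤⟨ handshake-≤ Q? upper? Q⇒b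
                                          (λ (y∈ , r) → R⇒Q y∈ r) (subsets n) ⟩
      b * # Q?                       ∎
      where open ≤-Reasoning

    downwards : (∀ {Y} → Q Y → a ≤ Σ (χ ∘ upper? Y)) →
                (∀ {X} → P X → Σ (χ ∘ lower? X) ≤ b) →
                (∀ {X y} → y ∉ X → R (X ∪ ⁅ y ⁆) y → P X) →
                a * # Q? ≤ b * # P?
    downwards Q⇒a P⇒b R⇒P = begin
      a * # Q?                       ≤⟨ handshake-≥ Q? upper? Q⇒a (subsets n) ⟩
      Σ (λ y → # (λ X → upper? X y)) ≡⟨ upper≡lower ⟩
      Σ (λ y → # (λ X → lower? X y)) ≤⟨ handshake-≤ P? lower? P⇒b
                                          (λ (y∉ , r) → R⇒P y∉ r) (subsets n) ⟩
      b * # P?                       ∎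
      where open ≤-Reasoning

-- Subsets, layers of the Boolean lattice and packings in a layer.

x∈p─q⇒x∉q : ∀ (p q : Subset n) → x ∈ p ─ q → x ∉ q
x∈p─q⇒x∉q (_ ∷ p) (inside  ∷ q) (there x∈) (there x∈q) = x∈p─q⇒x∉q p q x∈ x∈q
x∈p─q⇒x∉q (_ ∷ p) (outside ∷ q) (there x∈) (there x∈q) = x∈p─q⇒x∉q p q x∈ x∈q

∣p∣+∣q─p∣≡∣q∣ : ∀ (p q : Subset n) → p ⊆ q → ∣ p ∣ + ∣ q ─ p ∣ ≡ ∣ q ∣
∣p∣+∣q─p∣≡∣q∣ []            []            _   = refl
∣p∣+∣q─p∣≡∣q∣ (inside  ∷ p) (inside  ∷ q) p⊆q = cong suc (∣p∣+∣q─p∣≡∣q∣ p q (drop-∷-⊆ p⊆q))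
∣p∣+∣q─p∣≡∣q∣ (inside  ∷ p) (outside ∷ q) p⊆q with () ← p⊆q here
∣p∣+∣q─p∣≡∣q∣ (outside ∷ p) (inside  ∷ q) p⊆q =
  trans (+-suc ∣ p ∣ ∣ q ─ p ∣) (cong suc (∣p∣+∣q─p∣≡∣q∣ p q (drop-∷-⊆ p⊆q)))
∣p∣+∣q─p∣≡∣q∣ (outside ∷ p) (outside ∷ q) p⊆q = ∣p∣+∣q─p∣≡∣q∣ p q (drop-∷-⊆ p⊆q)

p∪⁅x⁆⊆q : p ⊆ q → x ∈ q → p ∪ ⁅ x ⁆ ⊆ q
p∪⁅x⁆⊆q p⊆q x∈q z∈ = [ p⊆q , (λ { refl → x∈q }) ]′ (x∈p∪⁅y⁆⁻ z∈)

p∪⁅x⁆-x≡p : x ∉ p → (p ∪ ⁅ x ⁆) - x ≡ p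
p∪⁅x⁆-x≡p x∉p = ⊆-antisym
  (λ z∈ → let z∈p∪x , z≢x = x∈p-y⁻ z∈ in
          [ id , (λ z≡x → contradiction z≡x z≢x) ]′ (x∈p∪⁅y⁆⁻ z∈p∪x))
  (λ z∈p → x∈p∧x≢y⇒x∈p-y (x∈p⇒x∈p∪⁅y⁆ z∈p) λ { refl → x∉p z∈p })

p-x∪⁅x⁆≡p : x ∈ p → (p - x) ∪ ⁅ x ⁆ ≡ p
p-x∪⁅x⁆≡p {x = x} {p = p} x∈p = ⊆-antisym (p∪⁅x⁆⊆q (proj₁ ∘ x∈p-y⁻) x∈p) to
  where
  to : p ⊆ (p - x) ∪ ⁅ x ⁆
  to {z} z∈p with z ∈? ⁅ x ⁆
  ... | yes z∈x = x∈p∪q⁺ (inj₂ z∈x)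
  ... | no  z∉x = x∈p∪q⁺ (inj₁ (x∈p∧x∉q⇒x∈p─q z∈p z∉x))

∪-swap : ∀ (p q r : Subset n) → (p ∪ q) ∪ r ≡ (p ∪ r) ∪ q
∪-swap p q r = trans (∪-assoc p q r) (trans (cong (p ∪_) (∪-comm q r)) (sym (∪-assoc p r q)))

Layer : Subset n → ℕ → Pred (Subset n) 0ℓ
Layer F k X = X ⊆ F × ∣ X ∣ ≡ k

layer? : ∀ (F : Subset n) k → Decidable (Layer F k)
layer? F k X = (X ⊆? F) ×-dec (∣ X ∣ ≟ k)

layer-insert⁺ : ∀ {F} → Layer F k X → y ∈ F → y ∉ X → Layer F (suc k) (X ∪ ⁅ y ⁆)
layer-insert⁺ {X = X} {y = y} (X⊆F , ∣X∣≡k) y∈F y∉X =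
  (λ z∈ → p∪⁅x⁆⊆q X⊆F y∈F z∈) , trans (x∉p⇒∣p∪⁅x⁆∣≡1+∣p∣ X y y∉X) (cong suc ∣X∣≡k)

layer-insert⁻ : ∀ {F} → y ∉ X → Layer F (suc k) (X ∪ ⁅ y ⁆) → Layer F k X
layer-insert⁻ {y = y} {X = X} y∉X (⊆F , eq) =
  (λ z∈ → ⊆F (x∈p⇒x∈p∪⁅y⁆ z∈)) ,
  suc-injective (trans (sym (x∉p⇒∣p∪⁅x⁆∣≡1+∣p∣ X y y∉X)) eq)

module _ (F : Subset n) (∣F∣≡ : ∣ F ∣ ≡ k + j) where

  ∣F─X∣≡j : Layer F k X → ∣ F ─ X ∣ ≡ j
  ∣F─X∣≡j {X = X} (X⊆F , ∣X∣≡k) = +-cancelˡ-≡ k _ _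
    (trans (cong (_+ ∣ F ─ X ∣) (sym ∣X∣≡k)) (trans (∣p∣+∣q─p∣≡∣q∣ X F X⊆F) ∣F∣≡))

  open DoubleCounting (layer? F k) (layer? F (suc k)) (λ X _ → layer? F (suc k) X)

  -- A `k`-subset of `F` extends by each of the `j` remaining elements of `F`, and a set of size
  -- `suc k` has `suc k` elements to remove. Together with `layer-downwards` this is the binomial
  -- recurrence `(k + 1) * L (k + 1) = j * L k`.
  layer-upwards : j * # (layer? F k) ≤ suc k * # (layer? F (suc k))
  layer-upwards = upwards
    (λ {X} l → ≤-trans (≤-reflexive (sym (∣F─X∣≡j l)))
      (∣p∣≤Σχ (lower? X) (F ─ X) λ y∈ →
        let y∉X = x∈p─q⇒x∉q F X y∈ in y∉X , layer-insert⁺ l (p─q⊆p F X y∈) y∉X))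
    (λ {Y} l → ≤-trans (Σχ≤∣p∣ (upper? Y) Y proj₁) (≤-reflexive (proj₂ l)))
    (λ _ l → l)

  layer-downwards : suc k * # (layer? F (suc k)) ≤ j * # (layer? F k)
  layer-downwards = downwards
    (λ {Y} l → ≤-trans (≤-reflexive (sym (proj₂ l))) (∣p∣≤Σχ (upper? Y) Y (_, l)))
    (λ {X} l → ≤-trans
      (Σχ≤∣p∣ (lower? X) (F ─ X) λ (y∉X , Y⊆F , _) →
        x∈p∧x∉q⇒x∈p─q (Y⊆F (y∈p∪⁅y⁆ X _)) y∉X)
      (≤-reflexive (∣F─X∣≡j l)))
    layer-insert⁻

module _ {F : Subset n} {C : Pred (Subset n) 0ℓ} (C? : Decidable C) where

  -- Each member of `C` has `suc k` sets just below it, and the second hypothesis makes these lower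
  -- shadows disjoint.
  packing-downwards : C ⊆ᵖ Layer F (suc k) →
    (∀ {X y z} → y ∉ X → z ∉ X → C (X ∪ ⁅ y ⁆) → C (X ∪ ⁅ z ⁆) → y ≡ z) →
    suc k * # C? ≤ # (layer? F k)
  packing-downwards {k = k} C⊆L sparse = subst (suc k * # C? ≤_) (*-identityˡ _) (downwards
    (λ {Y} c → ≤-trans (≤-reflexive (sym (proj₂ (C⊆L c)))) (∣p∣≤Σχ (upper? Y) Y (_, c)))
    (λ {X} _ → Σχ-unique (lower? X) λ (y∉ , c) (z∉ , c′) → sparse y∉ z∉ c c′)
    (λ y∉X c → layer-insert⁻ y∉X (C⊆L c)))
    where open DoubleCounting (layer? F k) C? (λ X _ → C? X)

  -- Each member has `j` sets of `F` just above it. The same hypothesis makes upper shadows disjoint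
  -- too: distinct sets with a common cover also cover a common set, their intersection.
  packing-upwards : ∣ F ∣ ≡ k + j → C ⊆ᵖ Layer F k →
    (∀ {X y z} → y ∉ X → z ∉ X → C (X ∪ ⁅ y ⁆) → C (X ∪ ⁅ z ⁆) → y ≡ z) →
    j * # C? ≤ # (layer? F (suc k))
  packing-upwards {k = k} {j = j} ∣F∣≡ C⊆L sparse = subst (j * # C? ≤_) (*-identityˡ _) (upwards
    (λ {X} c → ≤-trans (≤-reflexive (sym (∣F─X∣≡j F ∣F∣≡ (C⊆L c))))
      (∣p∣≤Σχ (lower? X) (F ─ X) λ y∈ →
        let y∉X = x∈p─q⇒x∉q F X y∈ in
        y∉X , p─q⊆p F X y∈ , subst C (sym (p∪⁅x⁆-x≡p y∉X)) c))
    (λ {Y} _ → Σχ-unique (upper? Y) λ {y} {z} (y∈ , _ , c) (z∈ , _ , c′) → unique Y y∈ z∈ c c′)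
    (λ {Y} {y} y∈Y (y∈F , c) → subst (Layer F (suc k)) (p-x∪⁅x⁆≡p y∈Y)
      (layer-insert⁺ (C⊆L c) y∈F (x∉p-x Y y))))
    where
    -- Edges are now selected by their lower end `Y - y`, and `y ∈ F` keeps the upper end inside
    -- `F`.
    open DoubleCounting C? (layer? F (suc k)) (λ X y → (y ∈? F) ×-dec C? (X - y))

    unique : ∀ (Y : Subset _) {y z} → y ∈ Y → z ∈ Y → C (Y - y) → C (Y - z) → y ≡ z
    unique Y {y} {z} y∈ z∈ c c′ = decidable-stable (y ≟ᶠ z) λ y≢z →
      -- For `X = Y - y - z`, the sets `Y - y` and `Y - z` are `X ∪ ⁅ z ⁆` and `X ∪ ⁅ y ⁆`.
      y≢z (sym (sparse
        (λ z∈X → x∉p-x (Y - y) z z∈X)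
        (λ y∈X → x∉p-x Y y (proj₁ (x∈p-y⁻ y∈X)))
        (subst C (sym (p-x∪⁅x⁆≡p (x∈p∧x≢y⇒x∈p-y z∈ (≢-sym y≢z)))) c)
        (subst C (sym (trans (cong (_∪ ⁅ y ⁆) (p─x─y≡p─y─x Y y z))
                             (p-x∪⁅x⁆≡p (x∈p∧x≢y⇒x∈p-y y∈ y≢z)))) c′)))

-- From sparse paving to a condition inherited by minors.

⊆∧∣∣≥⇒≡ : p ⊆ q → ∣ q ∣ ≤ ∣ p ∣ → p ≡ q
⊆∧∣∣≥⇒≡ {p = p} {q = q} p⊆q ∣q∣≤∣p∣ = ⊆-antisym p⊆q λ {x} x∈q →
  decidable-stable (x ∈? p) λ x∉p →
    <⇒≱ (p⊂q⇒∣p∣<∣q∣ (p⊆q , x , x∈q , x∉p)) ∣q∣≤∣p∣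

x∈p⊕q⇒x∉p⊎x∉q : x ∈ p ⊕ q → x ∉ p ⊎ x ∉ q
x∈p⊕q⇒x∉p⊎x∉q {p = outside ∷ p} {q = _ ∷ q} here = inj₁ λ ()
x∈p⊕q⇒x∉p⊎x∉q {p = inside ∷ p} {q = outside ∷ q} here = inj₂ λ ()
x∈p⊕q⇒x∉p⊎x∉q {p = _ ∷ p} {q = _ ∷ q} (there x∈) =
  [ (λ x∉ → inj₁ λ { (there x∈p) → x∉ x∈p })
  , (λ x∉ → inj₂ λ { (there x∈q) → x∉ x∈q }) ]′ (x∈p⊕q⇒x∉p⊎x∉q x∈)

x∈p⊕q⇒x∈p⊎x∈q : x ∈ p ⊕ q → x ∈ p ⊎ x ∈ q
x∈p⊕q⇒x∈p⊎x∈q {x = zero} {p = inside ∷ p} {q = _ ∷ q} _ = inj₁ here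
x∈p⊕q⇒x∈p⊎x∈q {p = outside ∷ p} {q = inside ∷ q} here = inj₂ here
x∈p⊕q⇒x∈p⊎x∈q {p = _ ∷ p} {q = _ ∷ q} (there x∈) =
  [ inj₁ ∘ there , inj₂ ∘ there ]′ (x∈p⊕q⇒x∈p⊎x∈q x∈)

-- An element of `p` lies in both sets, so only `y` and `z` can survive. This contradicts the bound
-- in `SparsePaving` for neighbouring circuits.
∣p∪⁅y⁆⊕p∪⁅z⁆∣≤2 : ∀ (p : Subset n) y z → ∣ (p ∪ ⁅ y ⁆) ⊕ (p ∪ ⁅ z ⁆) ∣ ≤ 2
∣p∪⁅y⁆⊕p∪⁅z⁆∣≤2 p y z = ≤-trans (p⊆q⇒∣p∣≤∣q∣ sub) ∣yz∣≤2
  where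
  sub : (p ∪ ⁅ y ⁆) ⊕ (p ∪ ⁅ z ⁆) ⊆ ⁅ y ⁆ ∪ ⁅ z ⁆
  sub {x} x∈ with x ∈? p
  ... | yes x∈p = [ contradiction (x∈p⇒x∈p∪⁅y⁆ x∈p) , contradiction (x∈p⇒x∈p∪⁅y⁆ x∈p) ]′
                    (x∈p⊕q⇒x∉p⊎x∉q x∈)
  ... | no x∉p with x∈p⊕q⇒x∈p⊎x∈q {p = p ∪ ⁅ y ⁆} x∈
  ...   | inj₁ x∈py = x∈p∪q⁺ ([ (λ x∈p → contradiction x∈p x∉p) , inj₁ ]′ (x∈p∪q⁻ p ⁅ y ⁆ x∈py))
  ...   | inj₂ x∈pz = x∈p∪q⁺ ([ (λ x∈p → contradiction x∈p x∉p) , inj₂ ]′ (x∈p∪q⁻ p ⁅ z ⁆ x∈pz))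

  ∣yz∣≤2 : ∣ ⁅ y ⁆ ∪ ⁅ z ⁆ ∣ ≤ 2
  ∣yz∣≤2 with z ∈? ⁅ y ⁆
  ... | no z∉ = ≤-reflexive (trans (x∉p⇒∣p∪⁅x⁆∣≡1+∣p∣ ⁅ y ⁆ z z∉) (cong suc (∣⁅x⁆∣≡1 y)))
  ... | yes z∈ = ≤-trans (p⊆q⇒∣p∣≤∣q∣ (p∪⁅x⁆⊆q id z∈))
                       (≤-trans (≤-reflexive (∣⁅x⁆∣≡1 y)) (n≤1+n 1))

-- The form in which sparse paving passes to minors: the sets of rank size that
-- are not bases are pairwise non-adjacent in the Johnson graph.  The rank is
-- given by an arbitrary basis, as the rank field of a minor comes from another one.
Sparse : Matroid n → Set
Sparse M = ∀ {B X y z} → Basis B → ∣ B ∣ ≡ suc ∣ X ∣ → X ⊆ E → y ∈ E → z ∈ E →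
           y ∉ X → z ∉ X → y ≢ z → ¬ Basis (X ∪ ⁅ y ⁆) → Basis (X ∪ ⁅ z ⁆)
  where open Matroid M

module _ (M : Matroid n) where
  open Matroid M

  -- Dependent, because a basis containing `X` would equal it by size. Minimal, because a proper
  -- subset misses some `x` and so lies in `X - x`, which is independent by paving.
  nonbasis⇒circuit : Paving → X ⊆ E → ∣ X ∣ ≡ rank → ¬ Basis X → Circuit X
  nonbasis⇒circuit {X = X} paving X⊆E ∣X∣≡r ¬b =
    (X⊆E , λ (B , b , X⊆B) → ¬b (subst Basis
      (sym (⊆∧∣∣≥⇒≡ X⊆B (≤-reflexive (trans (∣basis∣≡rank M b) (sym ∣X∣≡r))))) b)) ,
    λ { {D} (D⊆X , x , x∈X , x∉D) (_ , ¬indep) →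
      let B , b , X-x⊆B = paving {S = X - x} (λ z∈ → X⊆E (proj₁ (x∈p-y⁻ z∈)))
                            (trans (sym (x∈p⇒∣p∣≡1+∣p-x∣ x∈X)) ∣X∣≡r)
      in ¬indep (B , b , λ z∈D →
           X-x⊆B (x∈p∧x≢y⇒x∈p-y (D⊆X z∈D) λ { refl → x∉D z∈D })) }

  -- If neither set were a basis, they would be distinct circuits of rank size with symmetric
  -- difference at most 2.
  sparsePaving⇒sparse : SparsePaving → Sparse M
  sparsePaving⇒sparse (paving , sparse) {B} {X} {y} {z} b ∣B∣≡ X⊆E y∈E z∈E y∉X z∉X y≢z ¬by =
    decidable-stable (basis? (X ∪ ⁅ z ⁆)) λ ¬bz →
      <⇒≱ (sparse (circuit y∈E y∉X ¬by) (circuit z∈E z∉X ¬bz) (size y∉X) (size z∉X)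
             λ eq → [ z∉X , y≢z ∘ sym ]′ (x∈p∪⁅y⁆⁻ (subst (z ∈_) (sym eq) (y∈p∪⁅y⁆ X z))))
          (∣p∪⁅y⁆⊕p∪⁅z⁆∣≤2 X y z)
    where
    size : x ∉ X → ∣ X ∪ ⁅ x ⁆ ∣ ≡ rank
    size x∉X = trans (x∉p⇒∣p∪⁅x⁆∣≡1+∣p∣ X _ x∉X) (trans (sym ∣B∣≡) (∣basis∣≡rank M b))

    circuit : x ∈ E → x ∉ X → ¬ Basis (X ∪ ⁅ x ⁆) → Circuit (X ∪ ⁅ x ⁆)
    circuit x∈E x∉X = nonbasis⇒circuit paving (p∪⁅x⁆⊆q X⊆E x∈E) (size x∉X)

-- Under deletion the same `X` serves in `N`. Under contraction `X ∪ ⁅ e ⁆` serves: adding `e` to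
-- `X` and to `B` raises both sizes by one and keeps the two sets one exchange apart.
sparse-minor : {M N : Matroid n} → Sparse M → Minor M N → Sparse N
sparse-minor sparse self = sparse
sparse-minor sparse (deletion {N} {e} minor _ _ _)
  (_ , b) ∣B∣≡ X⊆ y∈ z∈ y∉X z∉X y≢z ¬by =
  (λ w∈ → p∪⁅x⁆⊆q X⊆ z∈ w∈) ,
  sparse-minor {N = N} sparse minor b ∣B∣≡ (proj₁ ∘ x∈p-y⁻ ∘ X⊆)
    (proj₁ (x∈p-y⁻ y∈)) (proj₁ (x∈p-y⁻ z∈))
    y∉X z∉X y≢z λ by → ¬by ((λ w∈ → p∪⁅x⁆⊆q X⊆ y∈ w∈) , by)
sparse-minor sparse (contraction {N} {e} minor e∈E _ _)
  {B} {X} {y} {z} (B⊆ , b) ∣B∣≡ X⊆ y∈ z∈ y∉X z∉X y≢z ¬by =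
  (λ w∈ → p∪⁅x⁆⊆q X⊆ z∈ w∈) ,
  subst Basis (∪-swap X ⁅ e ⁆ ⁅ z ⁆)
    (sparse-minor {N = N} sparse minor b
      (trans (x∉p⇒∣p∪⁅x⁆∣≡1+∣p∣ B e (λ e∈B → proj₂ (x∈p-y⁻ (B⊆ e∈B)) refl))
        (cong suc (trans ∣B∣≡ (sym (x∉p⇒∣p∪⁅x⁆∣≡1+∣p∣ X e λ e∈X → proj₂ (x∈p-y⁻ (X⊆ e∈X)) refl)))))
      (p∪⁅x⁆⊆q (proj₁ ∘ x∈p-y⁻ ∘ X⊆) e∈E) (proj₁ (x∈p-y⁻ y∈)) (proj₁ (x∈p-y⁻ z∈))
      ([ y∉X , proj₂ (x∈p-y⁻ y∈) ]′ ∘ x∈p∪⁅y⁆⁻) ([ z∉X , proj₂ (x∈p-y⁻ z∈) ]′ ∘ x∈p∪⁅y⁆⁻) y≢z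
      λ by → ¬by ((λ w∈ → p∪⁅x⁆⊆q X⊆ y∈ w∈) , subst Basis (∪-swap X ⁅ e ⁆ ⁅ y ⁆) by))
  where open Matroid N

-- Arithmetic of layer sizes.

-- `B` stands for the size of a layer split into `b` good and `c` bad sets, `L` for that of a
-- neighbouring layer. Chaining gives `q * (suc s * c) ≤ suc s * L ≤ q * B`, so at most a fraction
-- `1 / (s + 1)` is bad.
large-part : ∀ s q {b c B L} → .{{NonZero q}} →
             b + c ≡ B → q * c ≤ L → suc s * L ≤ q * B → s * B ≤ suc s * b
large-part s q {b} {c} {_} {L} refl qc≤L sL≤qB =
  +-cancelˡ-≤ (suc s * c) _ _ (begin
    suc s * c + s * (b + c)  ≤⟨ +-monoˡ-≤ _ (*-cancelˡ-≤ q qsc≤qB) ⟩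
    (b + c) + s * (b + c)    ≡⟨ eq s b c ⟩
    suc s * c + suc s * b    ∎)
  where
  open ≤-Reasoning
  eq : ∀ s b c → (b + c) + s * (b + c) ≡ suc s * c + suc s * b
  eq = solve-∀
  comm : ∀ q s c → q * (suc s * c) ≡ suc s * (q * c)
  comm = solve-∀
  qsc≤qB : q * (suc s * c) ≤ q * (b + c)
  qsc≤qB = begin
    q * (suc s * c) ≡⟨ comm q s c ⟩
    suc s * (q * c) ≤⟨ *-monoʳ-≤ (suc s) qc≤L ⟩
    suc s * L       ≤⟨ sL≤qB ⟩
    q * (b + c)     ∎

-- `large-part` bounds `b` and, with `s` and `q` interchanged, `b′`. The resulting fractions
-- `s / (s + 1)` and `q / (q + 1)` multiply to the upper bound that `h₁` and `h₂` give for `L₋ * L₊`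
-- relative to `L * L`.
log-concavity : ∀ s q {L₋ L L₊ b b′ c c′} → .{{NonZero s}} → .{{NonZero q}} →
  suc q * L₋ ≤ s * L → suc s * L₊ ≤ q * L →
  b + c ≡ L → b′ + c′ ≡ L → q * c ≤ L₊ → s * c′ ≤ L₋ → L₋ * L₊ ≤ b * b′
log-concavity s q {L₋} {L} {L₊} {b} {b′} h₁ h₂ eq eq′ qc sc′ =
  *-cancelˡ-≤ (suc s * suc q) (begin
    suc s * suc q * (L₋ * L₊)       ≡⟨ e₁ s q L₋ L₊ ⟩
    (suc q * L₋) * (suc s * L₊)     ≤⟨ *-mono-≤ h₁ h₂ ⟩
    (s * L) * (q * L)               ≤⟨ *-mono-≤ (large-part s q eq qc h₂) (large-part q s eq′ sc′ h₁) ⟩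
    (suc s * b) * (suc q * b′)      ≡⟨ e₂ s q b b′ ⟩
    suc s * suc q * (b * b′)        ∎)
  where
  open ≤-Reasoning
  e₁ : ∀ s q x y → suc s * suc q * (x * y) ≡ (suc q * x) * (suc s * y)
  e₁ = solve-∀
  e₂ : ∀ s q x y → (suc s * x) * (suc q * y) ≡ suc s * suc q * (x * y)
  e₂ = solve-∀

-- Counting bases by which of two elements they contain.

module _ (M : Matroid n) (sparse : Sparse M) where
  open Matroid M

  -- The link of `g` restricted to `F`, kept general in `g` so that it serves for both `e` and `f`.
  module Link {F : Subset n} {g : Fin n} {s : ℕ} (F⊆E : F ⊆ E) (g∈E : g ∈ E) (g∉F : g ∉ F)
              (rank≡ : rank ≡ suc s) where

    Completed : Pred (Subset n) 0ℓ
    Completed X = Basis (X ∪ ⁅ g ⁆)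

    completed? : Decidable Completed
    completed? X = basis? (X ∪ ⁅ g ⁆)

    good? = layer? F s ∩? completed?
    bad?  = layer? F s ∩? (¬? ∘ completed?)

    -- If `y ≢ z`, adding `y` or `z` to `X ∪ ⁅ g ⁆` would give two non-bases of rank size that are
    -- one exchange apart, against `sparse`.
    bad-sparse : y ∉ X → z ∉ X →
                 Layer F s (X ∪ ⁅ y ⁆) × ¬ Completed (X ∪ ⁅ y ⁆) →
                 Layer F s (X ∪ ⁅ z ⁆) × ¬ Completed (X ∪ ⁅ z ⁆) → y ≡ z
    bad-sparse {y = y} {X = X} {z = z} y∉X z∉X ((Xy⊆F , ∣Xy∣≡) , ¬by) ((Xz⊆F , _) , ¬bz) =
      decidable-stable (y ≟ᶠ z) λ y≢z →
        ¬bz (subst Basis (∪-swap X ⁅ g ⁆ ⁅ z ⁆)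
          (sparse {X = X ∪ ⁅ g ⁆} (proj₂ nonempty) size
            (p∪⁅x⁆⊆q (λ x∈X → F⊆E (X⊆F x∈X)) g∈E) (F⊆E y∈F) (F⊆E z∈F)
            ([ y∉X , (λ { refl → g∉F y∈F }) ]′ ∘ x∈p∪⁅y⁆⁻)
            ([ z∉X , (λ { refl → g∉F z∈F }) ]′ ∘ x∈p∪⁅y⁆⁻)
            y≢z (λ b → ¬by (subst Basis (∪-swap X ⁅ g ⁆ ⁅ y ⁆) b))))
      where
      y∈F : y ∈ F
      y∈F = Xy⊆F (y∈p∪⁅y⁆ X y)

      z∈F : z ∈ F
      z∈F = Xz⊆F (y∈p∪⁅y⁆ X z)

      X⊆F : X ⊆ F
      X⊆F x∈X = Xy⊆F (x∈p⇒x∈p∪⁅y⁆ x∈X)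

      size : rank ≡ suc ∣ X ∪ ⁅ g ⁆ ∣
      size = trans rank≡ (cong suc (trans (sym ∣Xy∣≡)
        (trans (x∉p⇒∣p∪⁅x⁆∣≡1+∣p∣ X y y∉X) (sym (x∉p⇒∣p∪⁅x⁆∣≡1+∣p∣ X g (g∉F ∘ X⊆F))))))

    good+bad : # good? + # bad? ≡ # (layer? F s)
    good+bad = sym (count-split (layer? F s) completed? (subsets n))

  module _ {e f : Fin n} (e∈E : e ∈ E) (f∈E : f ∈ E) (e≢f : e ≢ f) where

    private
      F : Subset n
      F = E - e - f

      F⊆E : F ⊆ E
      F⊆E = proj₁ ∘ x∈p-y⁻ ∘ proj₁ ∘ x∈p-y⁻

      e∉F : e ∉ F
      e∉F e∈F = x∉p-x E e (proj₁ (x∈p-y⁻ e∈F))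

      f∉F : f ∉ F
      f∉F = x∉p-x (E - e) f

      ⊆F : X ⊆ E → e ∉ X → f ∉ X → X ⊆ F
      ⊆F X⊆E e∉X f∉X x∈X =
        x∈p∧x≢y⇒x∈p-y (x∈p∧x≢y⇒x∈p-y (X⊆E x∈X) λ { refl → e∉X x∈X }) λ { refl → f∉X x∈X }

    -- In `both?` and `only?` the leading membership test is the one that the insertion bijection
    -- strips off.
    both? : Decidable (λ X → e ∈ X × f ∈ X × Basis X)
    both? X = (e ∈? X) ×-dec (f ∈? X) ×-dec basis? X

    only? : ∀ (g h : Fin n) → Decidable (λ X → g ∈ X × h ∉ X × Basis X)
    only? g h X = (g ∈? X) ×-dec ¬? (h ∈? X) ×-dec basis? X

    neither? : Decidable (λ X → e ∉ X × f ∉ X × Basis X)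
    neither? X = ¬? (e ∈? X) ×-dec ¬? (f ∈? X) ×-dec basis? X

    #both≡0 : rank ≤ 1 → # both? ≡ 0
    #both≡0 r≤1 = #-none both? λ {X} (e∈X , f∈X , b) →
      <⇒≱ (s≤s (s≤s z≤n)) (subst (_≤ 1) (trans (sym (∣basis∣≡rank M b))
        (trans (x∈p⇒∣p∣≡1+∣p-x∣ e∈X)
          (cong suc (x∈p⇒∣p∣≡1+∣p-x∣ (x∈p∧x≢y⇒x∈p-y f∈X (≢-sym e≢f)))))) r≤1)

    #both≤ : ∀ {t} → rank ≡ 2 + t → # both? ≤ # (layer? F t)
    #both≤ {t} rank≡ = begin
      # both? ≡⟨ #-insert e (λ X → (f ∈? X) ×-dec basis? X) ⟩
      # (λ X → ¬? (e ∈? X) ×-dec (f ∈? (X ∪ ⁅ e ⁆)) ×-dec basis? (X ∪ ⁅ e ⁆))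
        -- The test for `f` moves to the front for the second removal; `f ∈ X ∪ ⁅ e ⁆` gives `f ∈ X`
        -- because `e ≢ f`.
        ≤⟨ count-mono _ (λ X → (f ∈? X) ×-dec ¬? (e ∈? X) ×-dec basis? (X ∪ ⁅ e ⁆))
             (λ (e∉ , f∈ , b) →
               [ id , (λ f≡e → contradiction (sym f≡e) e≢f) ]′ (x∈p∪⁅y⁆⁻ f∈) , e∉ , b)
             (subsets n) ⟩
      # (λ X → (f ∈? X) ×-dec ¬? (e ∈? X) ×-dec basis? (X ∪ ⁅ e ⁆))
        ≡⟨ #-insert f (λ X → ¬? (e ∈? X) ×-dec basis? (X ∪ ⁅ e ⁆)) ⟩
      # (λ X → ¬? (f ∈? X) ×-dec ¬? (e ∈? (X ∪ ⁅ f ⁆)) ×-dec basis? ((X ∪ ⁅ f ⁆) ∪ ⁅ e ⁆))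
        ≤⟨ count-mono _ (layer? F t) (λ {X} (f∉ , e∉ , b) →
             (λ x∈ → ⊆F (basis⊆E b ∘ x∈p⇒x∈p∪⁅y⁆ ∘ x∈p⇒x∈p∪⁅y⁆) (e∉ ∘ x∈p⇒x∈p∪⁅y⁆) f∉ x∈) ,
             suc-injective (suc-injective (trans
               (sym (trans (x∉p⇒∣p∪⁅x⁆∣≡1+∣p∣ (X ∪ ⁅ f ⁆) e e∉)
                           (cong suc (x∉p⇒∣p∪⁅x⁆∣≡1+∣p∣ X f f∉))))
               (trans (∣basis∣≡rank M b) rank≡))))
             (subsets n) ⟩
      # (layer? F t) ∎
      where open ≤-Reasoning

    #neither≤ : # neither? ≤ # (layer? F rank)
    #neither≤ = count-mono neither? (layer? F rank)
      (λ (e∉ , f∉ , b) → (λ x∈ → ⊆F (basis⊆E b) e∉ f∉ x∈) , ∣basis∣≡rank M b) (subsets n)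

    ≤#only : ∀ {s g h} (g∈E : g ∈ E) (g∉F : g ∉ F) (h∉F : h ∉ F) (rank≡ : rank ≡ suc s) →
             g ≢ h →
             # (Link.good? F⊆E g∈E g∉F rank≡) ≤ # (only? g h)
    ≤#only {g = g} {h} g∈E g∉F h∉F rank≡ g≢h = begin
      # (Link.good? F⊆E g∈E g∉F rank≡)
        ≤⟨ count-mono _ (λ X → ¬? (g ∈? X) ×-dec ¬? (h ∈? (X ∪ ⁅ g ⁆)) ×-dec basis? (X ∪ ⁅ g ⁆))
             (λ ((X⊆F , _) , b) → (λ g∈ → g∉F (X⊆F g∈)) ,
               (λ h∈ → [ (λ h∈X → h∉F (X⊆F h∈X)) , g≢h ∘ sym ]′ (x∈p∪⁅y⁆⁻ h∈)) , b) (subsets n) ⟩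
      # (λ X → ¬? (g ∈? X) ×-dec ¬? (h ∈? (X ∪ ⁅ g ⁆)) ×-dec basis? (X ∪ ⁅ g ⁆))
        ≡⟨ #-insert g (λ X → ¬? (h ∈? X) ×-dec basis? X) ⟨
      # (only? g h) ∎
      where open ≤-Reasoning

    both*neither≤only*only : # both? * # neither? ≤ # (only? e f) * # (only? f e)
    both*neither≤only*only = go rank refl
      where
      open ≤-Reasoning

      go : ∀ r → rank ≡ r → # both? * # neither? ≤ # (only? e f) * # (only? f e)
      go 0 eq = ≤-trans
        (≤-reflexive (cong (_* # neither?) (#both≡0 (subst (_≤ 1) (sym eq) z≤n)))) z≤n
      go 1 eq = ≤-trans
        (≤-reflexive (cong (_* # neither?) (#both≡0 (≤-reflexive eq)))) z≤n
      go (suc (suc t)) eq with suc (suc t) ≤? ∣ F ∣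
      -- A basis avoiding both elements lies in `F`, which is too small here.
      ... | no ∣F∣≱ = ≤-trans
        (≤-reflexive (trans (cong (# both? *_) #neither≡0) (*-zeroʳ (# both?)))) z≤n
        where
        #neither≡0 : # neither? ≡ 0
        #neither≡0 = n≤0⇒n≡0 (≤-trans #neither≤ (≤-reflexive (#-none (layer? F rank)
          λ (X⊆F , ∣X∣≡) → ∣F∣≱ (subst (_≤ ∣ F ∣) (trans ∣X∣≡ eq) (p⊆q⇒∣p∣≤∣q∣ X⊆F)))))
      ... | yes le = let j , 2+t+j≡∣F∣ = m≤n⇒∃[o]m+o≡n le in main j (sym 2+t+j≡∣F∣)
        where
        module Lᵉ = Link F⊆E e∈E e∉F eq
        module Lᶠ = Link F⊆E f∈E f∉F eq

        main : ∀ j → ∣ F ∣ ≡ 2 + t + j → # both? * # neither? ≤ # (only? e f) * # (only? f e)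
        main j ∣F∣≡ = begin
          # both? * # neither?
            ≤⟨ *-mono-≤ (#both≤ eq)
                 (≤-trans #neither≤ (≤-reflexive (cong (λ r → # (layer? F r)) eq))) ⟩
          # (layer? F t) * # (layer? F (2 + t))
            -- Here `s = suc t` and `q = suc j`; the cases already settled are those where one of
            -- them would not be positive. Bad sets for `e` are packed by upper shadows, those for
            -- `f` by lower shadows.
            ≤⟨ log-concavity (suc t) (suc j) (layer-upwards F ∣F∣≡₀) (layer-downwards F ∣F∣≡₁)
                 Lᵉ.good+bad Lᶠ.good+bad
                 (packing-upwards Lᵉ.bad? ∣F∣≡₁ proj₁ Lᵉ.bad-sparse)
                 (packing-downwards Lᶠ.bad? proj₁ Lᶠ.bad-sparse) ⟩
          # Lᵉ.good? * # Lᶠ.good?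
            ≤⟨ *-mono-≤ (≤#only e∈E e∉F f∉F eq e≢f) (≤#only f∈E f∉F e∉F eq (≢-sym e≢f)) ⟩
          # (only? e f) * # (only? f e) ∎
          where
          -- Splitting `∣ F ∣` at `s` leaves `q`; splitting it at `s - 1` below leaves `q + 1`.
          ∣F∣≡₁ : ∣ F ∣ ≡ suc t + suc j
          ∣F∣≡₁ = trans ∣F∣≡ (sym (+-suc (suc t) j))

          ∣F∣≡₀ : ∣ F ∣ ≡ t + suc (suc j)
          ∣F∣≡₀ = trans ∣F∣≡₁ (sym (+-suc t (suc j)))

    private
      w u v o : ℕ
      w = # both?
      u = # (only? e f)
      v = # (only? f e)
      o = # neither?

      #e≡ : # (basis? ∩? (e ∈?_)) ≡ w + u
      #e≡ = trans (count-split _ (f ∈?_) (subsets n)) (cong₂ _+_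
        (count-cong _ both?
          ((λ ((b , e∈) , f∈) → e∈ , f∈ , b) ,
           (λ (e∈ , f∈ , b) → (b , e∈) , f∈)) (subsets n))
        (count-cong _ (only? e f)
          ((λ ((b , e∈) , f∉) → e∈ , f∉ , b) ,
           (λ (e∈ , f∉ , b) → (b , e∈) , f∉)) (subsets n)))

      #f≡ : # (basis? ∩? (f ∈?_)) ≡ w + v
      #f≡ = trans (count-split _ (e ∈?_) (subsets n)) (cong₂ _+_
        (count-cong _ both?
          ((λ ((b , f∈) , e∈) → e∈ , f∈ , b) ,
           (λ (e∈ , f∈ , b) → (b , f∈) , e∈)) (subsets n))
        (count-cong _ (only? f e)
          ((λ ((b , f∈) , e∉) → f∈ , e∉ , b) ,
           (λ (f∈ , e∉ , b) → (b , f∈) , e∉)) (subsets n)))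

      #¬e≡ : # (basis? ∩? (¬? ∘ (e ∈?_))) ≡ v + o
      #¬e≡ = trans (count-split _ (f ∈?_) (subsets n)) (cong₂ _+_
        (count-cong _ (only? f e)
          ((λ ((b , e∉) , f∈) → f∈ , e∉ , b) ,
           (λ (f∈ , e∉ , b) → (b , e∉) , f∈)) (subsets n))
        (count-cong _ neither?
          ((λ ((b , e∉) , f∉) → e∉ , f∉ , b) ,
           (λ (e∉ , f∉ , b) → (b , e∉) , f∉)) (subsets n)))

      #basis≡ : # basis? ≡ (w + u) + (v + o)
      #basis≡ = trans (count-split basis? (e ∈?_) (subsets n)) (cong₂ _+_ #e≡ #¬e≡)

      #e∩f≡ : # (basis? ∩? ((e ∈?_) ∩? (f ∈?_))) ≡ w
      #e∩f≡ = count-cong _ both?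
        ((λ (b , e∈ , f∈) → e∈ , f∈ , b) , (λ (e∈ , f∈ , b) → b , e∈ , f∈)) (subsets n)

    -- In the four counts both sides share `w * (w + u + v)`, which leaves `w * o ≤ u * v`.
    count-correlation : # (basis? ∩? ((e ∈?_) ∩? (f ∈?_))) * # basis? ≤
                        # (basis? ∩? (e ∈?_)) * # (basis? ∩? (f ∈?_))
    count-correlation = begin
      # (basis? ∩? ((e ∈?_) ∩? (f ∈?_))) * # basis? ≡⟨ cong₂ _*_ #e∩f≡ #basis≡ ⟩
      w * ((w + u) + (v + o))                       ≡⟨ e₁ w u v o ⟩
      w * (w + u + v) + w * o                       ≤⟨ +-monoʳ-≤ (w * (w + u + v)) both*neither≤only*only ⟩
      w * (w + u + v) + u * v                       ≡⟨ e₂ w u v ⟩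
      (w + u) * (w + v)                             ≡⟨ cong₂ _*_ #e≡ #f≡ ⟨
      # (basis? ∩? (e ∈?_)) * # (basis? ∩? (f ∈?_)) ∎
      where
      open ≤-Reasoning
      e₁ : ∀ w u v o → w * ((w + u) + (v + o)) ≡ w * (w + u + v) + w * o
      e₁ = solve-∀
      e₂ : ∀ w u v → w * (w + u + v) + u * v ≡ (w + u) * (w + v)
      e₂ = solve-∀

-- From counts to probabilities.

-- Multiplying by `c / d` turns the claim into `a / d ≤ (b / d) * (c / d)`, the hypothesis divided
-- by `d * d`.
/-÷-/-≤ : ∀ a b c d .{{_ : NonZero c}} .{{_ : NonZero d}} → a * d ≤ b * c →
          .{{_ : ℚ.NonZero (ℤ.+ c ℚ./ d)}} → (ℤ.+ a ℚ./ d) ℚ.÷ (ℤ.+ c ℚ./ d) ℚ.≤ ℤ.+ b ℚ./ d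
/-÷-/-≤ a b c d@(suc d-1) ad≤bc = ℚ.*-cancelʳ-≤-pos c/d {{ℚ.normalize-pos c d}} (begin
  a/d ℚ.* ℚ.1/ c/d ℚ.* c/d   ≡⟨ ℚ.*-assoc a/d (ℚ.1/ c/d) c/d ⟩
  a/d ℚ.* (ℚ.1/ c/d ℚ.* c/d) ≡⟨ cong (a/d ℚ.*_) (ℚ.*-inverseˡ c/d) ⟩
  a/d ℚ.* ℚ.1ℚ               ≡⟨ ℚ.*-identityʳ a/d ⟩
  a/d                        ≤⟨ ℚ.toℚᵘ-cancel-≤ a/d≤b/d*c/d ⟩
  b/d ℚ.* c/d                ∎)
  where
  open ℚ.≤-Reasoning
  a/d = ℤ.+ a ℚ./ d
  b/d = ℤ.+ b ℚ./ d
  c/d = ℤ.+ c ℚ./ d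

  -- `ℚ./` reduces to lowest terms, so the comparison is made between unnormalised fractions with
  -- explicit denominators.
  toℚᵘ-/ : ∀ m → ℚ.toℚᵘ (ℤ.+ m ℚ./ d) ℚᵘ.≃ ℚᵘ.mkℚᵘ (ℤ.+ m) d-1
  toℚᵘ-/ m = ℚ.toℚᵘ-fromℚᵘ (ℚᵘ.mkℚᵘ (ℤ.+ m) d-1)

  -- The product on the right has denominator `d * d`, hence one more factor `d` on both sides than
  -- in `ad≤bc`.
  cross : ℤ.+ a ℤ.* ℤ.+ (d * d) ℤ.≤ ℤ.+ b ℤ.* ℤ.+ c ℤ.* ℤ.+ d
  cross = subst₂ ℤ._≤_ (ℤ.pos-* a (d * d))
    (trans (ℤ.pos-* (b * c) d) (cong (ℤ._* ℤ.+ d) (ℤ.pos-* b c)))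
    (ℤ.+≤+ (subst (_≤ b * c * d) (*-assoc a d d) (*-monoˡ-≤ d ad≤bc)))

  a/d≤b/d*c/d : ℚ.toℚᵘ a/d ℚᵘ.≤ ℚ.toℚᵘ (b/d ℚ.* c/d)
  a/d≤b/d*c/d = ℚᵘ.≤-respˡ-≃ (ℚᵘ.≃-sym (toℚᵘ-/ a)) (ℚᵘ.≤-respʳ-≃
    (ℚᵘ.≃-sym (ℚᵘ.≃-trans (ℚ.toℚᵘ-homo-* b/d c/d) (ℚᵘ.*-cong (toℚᵘ-/ b) (toℚᵘ-/ c))))
    (ℚᵘ.*≤* cross))

sparse⇒negativelyCorrelated : (M : Matroid n) → Sparse M → NegativelyCorrelated M
sparse⇒negativelyCorrelated M sparse {e} {f} e∈E f∈E e≢f ¬loop =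
  /-÷-/-≤ (# (basis? ∩? ((e ∈?_) ∩? (f ∈?_)))) (# (basis? ∩? (e ∈?_)))
    (# (basis? ∩? (f ∈?_))) (# basis?)
    {{#-nonZero (basis? ∩? (f ∈?_)) (¬loop⇒∃basis M f∈E ¬loop)}} {{#-nonZero basis? nonempty}}
    (count-correlation M sparse e∈E f∈E e≢f)
    {{Pr-nonZero M (f ∈?_) (¬loop⇒∃basis M f∈E ¬loop)}}
  where open Matroid M

lemma2 : ∀ {n : ℕ} (M : Matroid n) → Matroid.SparsePaving M → Balanced M
lemma2 M sp {N} minor =
  sparse⇒negativelyCorrelated N (sparse-minor {N = N} (sparsePaving⇒sparse M sp) minor)
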